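{- Let $\mathcal{K}$ be a regular $n$-polytope that is $(1,n-1)$-flat. Then no finite chiral $(n+1)$-polytope has facets isomorphic to $\mathcal{K}$.
   Context: An (abstract) $n$-polytope is a partially ordered set with a unique minimal face $F_{ -1}$ and a unique maximal face $F_n$, all of whose maximal chains (flags) have the same length, graded by a rank function with $\operatorname{rank}F_{ -1}=-1$, $\operatorname{rank}F_n=n$, satisfying the diamond condition (if $F<G$ with rank difference $2$, exactly two faces lie strictly between them) and strong connectivity (if $F<G$ with rank difference at least $3$, any two faces strictly between $F$ and $G$ are joined by a chain $H_0\le H_1\ge H_2\le\cdots$ of faces strictly between $F$ and $G$). Faces of rank $0$ are vertices, of rank $n-1$ facets; a facet $F$ is identified with the $(n-1)$-polytope $\{H: F_{ -1}\le H\le F\}$. Flags differing in exactly one face are adjacent. A polytope is regular if its automorphism group (rank- and order-preserving bijections) acts transitively on flags, and chiral if the flags form two orbits with adjacent flags in different orbits. For $0\le k<m\le n-1$, an $n$-polytope is $(k,m)$-flat if every face of rank $k$ is incident with (comparable to) every face of rank $m$. -}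

module Defs where

open import Data.Nat using (ℕ; suc; _+_)
open import Data.Integer as ℤ using (ℤ; +_; -[1+_]; _-_) renaming (_+_ to _+ℤ_; _≤_ to _≤ℤ_; _<_ to _<ℤ_)
open import Data.Fin using (Fin; toℕ) renaming (_≤_ to _≤F_)
open import Data.Product using (Σ; ∃; ∃-syntax; _×_; _,_)
open import Data.Sum using (_⊎_)
open import Function.Bundles using (_↔_)
open import Relation.Nullary using (¬_)
open import Relation.Binary.PropositionalEquality using (_≡_; _≢_)
open import Relation.Binary.Structures using (IsPartialOrder)
open import Relation.Binary.Construct.Closure.ReflexiveTransitive using (Star)

record Polytope (n : ℕ) : Set₁ where
  field
    Face    : Set
    _≤_     : Face → Face → Set
    isPO    : IsPartialOrder _≡_ _≤_
    rank    : Face → ℤ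
    Fmin    : Face
    Fmax    : Face
    Fmin≤   : ∀ F → Fmin ≤ F
    ≤Fmax   : ∀ F → F ≤ Fmax
    rank-min : rank Fmin ≡ -[1+ 0 ]
    rank-max : rank Fmax ≡ + n

  _<_ : Face → Face → Set
  F < G = F ≤ G × F ≢ G

  Incident : Face → Face → Set
  Incident F G = F ≤ G ⊎ G ≤ F

  IsChain : (Face → Set) → Set
  IsChain Φ = ∀ x y → Φ x → Φ y → Incident x y

  IsMaximalChain : (Face → Set) → Set
  IsMaximalChain Φ = IsChain Φ × (∀ z → (∀ x → Φ x → Incident z x) → Φ z)

  Between : Face → Face → Face → Set
  Between F G H = F < H × H < G

  LinkIn : Face → Face → Face → Face → Set
  LinkIn F G H H' = Between F G H × Between F G H' × Incident H H'

  field
    rank-mono : ∀ {F G} → F < G → rank F <ℤ rank G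
    -- gradedness: every maximal chain (flag) contains a face of every rank
    -- -1,…,n; hence all flags have the same length n+2
    graded    : ∀ Φ → IsMaximalChain Φ →
                ∀ r → -[1+ 0 ] ≤ℤ r → r ≤ℤ + n → ∃[ H ] (Φ H × rank H ≡ r)
    diamond   : ∀ F G → F < G → rank G ≡ rank F +ℤ + 2 →
                ∃[ H₁ ] ∃[ H₂ ] (Between F G H₁ × Between F G H₂ × H₁ ≢ H₂ ×
                  (∀ H → Between F G H → H ≡ H₁ ⊎ H ≡ H₂))
    strongly-connected : ∀ F G → F < G → rank F +ℤ + 3 ≤ℤ rank G →
                ∀ H H' → Between F G H → Between F G H' → Star (LinkIn F G) H H'

  record Flag : Set where
    field
      face      : Fin (suc (suc n)) → Face
      face-rank : ∀ i → rank (face i) ≡ + toℕ i - + 1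
      face-chain : ∀ {i j} → i ≤F j → face i ≤ face j
  open Flag public

  Adjacent : Flag → Flag → Set
  Adjacent Φ Ψ = ∃[ i ] (face Φ i ≢ face Ψ i × (∀ j → j ≢ i → face Φ j ≡ face Ψ j))

  record Automorphism : Set where
    field
      to      : Face → Face
      from    : Face → Face
      to-from : ∀ F → to (from F) ≡ F
      from-to : ∀ F → from (to F) ≡ F
      to-mono : ∀ {F G} → F ≤ G → to F ≤ to G
      to-refl : ∀ {F G} → to F ≤ to G → F ≤ G
      to-rank : ∀ F → rank (to F) ≡ rank F
  open Automorphism public

  SameOrbit : Flag → Flag → Set
  SameOrbit Φ Ψ = ∃[ α ] (∀ i → to α (face Φ i) ≡ face Ψ i)

  IsRegular : Set
  IsRegular = ∀ Φ Ψ → SameOrbit Φ Ψ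

  IsChiral : Set
  IsChiral = (∃[ Φ₀ ] ∃[ Φ₁ ] (¬ SameOrbit Φ₀ Φ₁ × (∀ Ψ → SameOrbit Φ₀ Ψ ⊎ SameOrbit Φ₁ Ψ)))
           × (∀ Φ Ψ → Adjacent Φ Ψ → ¬ SameOrbit Φ Ψ)

  IsFinite : Set
  IsFinite = ∃[ m ] (Face ↔ Fin m)

  IsFlat : ℤ → ℤ → Set
  IsFlat k m = ∀ F G → rank F ≡ k → rank G ≡ m → Incident F G

open Polytope public

record FacetIso {n : ℕ} (P : Polytope (suc n)) (F : Face P) (K : Polytope n) : Set where
  field
    to      : ∀ H → _≤_ P H F → Face K
    from    : Face K → Face P
    from≤   : ∀ y → _≤_ P (from y) F
    to-from : ∀ y → to (from y) (from≤ y) ≡ y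
    from-to : ∀ H (p : _≤_ P H F) → from (to H p) ≡ H
    to-mono : ∀ H H' (p : _≤_ P H F) (p' : _≤_ P H' F) → _≤_ P H H' → _≤_ K (to H p) (to H' p')
    to-refl : ∀ H H' (p : _≤_ P H F) (p' : _≤_ P H' F) → _≤_ K (to H p) (to H' p') → _≤_ P H H'

HasFacets : {n : ℕ} → Polytope (suc n) → Polytope n → Set
HasFacets {n} P K = ∀ F → rank P F ≡ + n → FacetIso P F K

{-# OPTIONS --safe #-}

-- Fix a flag with vertex v and edge e, and let v' be the other vertex of e.
-- By flatness and connectivity every facet, and every ridge, contains e.  Since
-- K is regular, every facet F has a reflection that exchanges v and v' and fixes
-- all faces between e and F; by rigidity it is determined by these properties.
-- Two facets sharing a ridge R induce the same map below R, because e lies below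
-- R, so the reflections glue to an automorphism of P that maps the flag to an
-- adjacent one.
module Submission where

open import Defs using (Polytope; IsRegular; IsFlat; IsFinite; IsChiral; HasFacets; FacetIso)
open import Data.Nat using (ℕ; zero; suc; _+_; _∸_; _≤_; _<_; _≤?_; z≤n; s≤s; s≤s⁻¹)
open import Data.Nat.Properties hiding (_≟_)
open import Data.Integer using (+_; _-_)
open import Data.Integer as ℤ using (ℤ; -[1+_])
import Data.Integer.Properties as ℤ
open import Data.Fin using (Fin; zero; suc; toℕ; inject₁; fromℕ<)
open import Data.Fin.Properties using (toℕ<n; toℕ-inject₁; toℕ-fromℕ<)
import Data.Fin.Properties as Fin
open import Data.List using (List; []; _∷_; map; allFin)
open import Data.List.Membership.Propositional using (_∈_)
open import Data.List.Membership.Propositional.Properties using (∈-map⁺; ∈-allFin)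
open import Data.List.Relation.Unary.All using (All; all?; []; _∷_)
import Data.List.Relation.Unary.All as All
open import Data.List.Relation.Unary.Any using (here; there)
open import Data.Product using (Σ; ∃-syntax; _×_; _,_; proj₁; proj₂)
open import Data.Sum using (inj₁; inj₂; swap)
open import Function using (id; _∘_)
open import Function.Bundles using (Inverse)
open import Function.Properties.Inverse using (↔⇒↣)
open import Relation.Binary using (DecidableEquality; IsPartialOrder)
open import Relation.Binary.Construct.Closure.ReflexiveTransitive using (Star; ε; _◅_)
open import Relation.Binary.PropositionalEquality
open import Relation.Nullary using (¬_; Dec; yes; no; contradiction)
open import Relation.Nullary.Decidable using (_⊎-dec_; via-injection; ¬¬-excluded-middle)

-- Ranks as natural numbers.

-- Ranks are shifted by one to live in ℕ; below -1 the value is junk.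
index : ℤ → ℕ
index (+ k)    = suc k
index -[1+ _ ] = 0

index-inverse : ∀ {z} → -[1+ 0 ] ℤ.≤ z → z ≡ + index z - + 1
index-inverse {+ k}         _             = refl
index-inverse { -[1+ .0 ] } (ℤ.-≤- z≤n)   = refl

index-minus-one : ∀ i → index (+ i - + 1) ≡ i
index-minus-one zero    = refl
index-minus-one (suc i) = refl

index-mono-< : ∀ {y z} → -[1+ 0 ] ℤ.≤ y → y ℤ.< z → index y < index z
index-mono-< _           (ℤ.+<+ i<j)  = s≤s i<j
index-mono-< _           ℤ.-<+        = s≤s z≤n
index-mono-< (ℤ.-≤- z≤n) (ℤ.-<- ())

minus-one-mono-≤ : ∀ {i j} → i ≤ j → (+ i - + 1) ℤ.≤ (+ j - + 1)
minus-one-mono-≤ i≤j = ℤ.+-monoˡ-≤ -[1+ 0 ] (ℤ.+≤+ i≤j)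

minus-one-shift : ∀ k i → + (k + i) - + 1 ≡ (+ i - + 1) ℤ.+ + k
minus-one-shift k i =
  trans (cong (λ z → z ℤ.+ -[1+ 0 ]) (ℤ.+-comm (+ k) (+ i)))
    (trans (ℤ.+-assoc (+ i) (+ k) -[1+ 0 ])
      (trans (cong (λ z → + i ℤ.+ z) (ℤ.+-comm (+ k) -[1+ 0 ]))
        (sym (ℤ.+-assoc (+ i) -[1+ 0 ] (+ k)))))

module Heights {N : ℕ} (P : Polytope N) where
  open Polytope P renaming (_≤_ to _⊑_; _<_ to _⊏_)

  height : Face → ℕ
  height x = index (rank x)

  rank≥-1 : ∀ x → -[1+ 0 ] ℤ.≤ rank x
  rank≥-1 x with -[1+ 0 ] ℤ.≤? rank x
  ... | yes p = p
  -- A face of rank below -1 would differ from `Fmin`, hence lie strictly above it and have a larger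
  -- rank.
  ... | no ¬p = contradiction (ℤ.<⇒≤ (subst (ℤ._< rank x) rank-min
                  (rank-mono (Fmin≤ x , λ { refl → ¬p (ℤ.≤-reflexive (sym rank-min)) })))) ¬p

  rank-height : ∀ x → rank x ≡ + height x - + 1
  rank-height x = index-inverse (rank≥-1 x)

  rank≡ : ∀ {x i} → height x ≡ i → rank x ≡ + i - + 1
  rank≡ {x} refl = rank-height x

  height≡ : ∀ {x i} → rank x ≡ + i - + 1 → height x ≡ i
  height≡ {i = i} eq = trans (cong index eq) (index-minus-one i)

  height-mono-< : ∀ {x y} → x ⊏ y → height x < height y
  height-mono-< {x} x⊏y = index-mono-< (rank≥-1 x) (rank-mono x⊏y)

  height-mono-≤ : ∀ {x y} → x ⊑ y → height x ≤ height y
  height-mono-≤ {x} {y} x⊑y with height x ≤? height y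
  ... | yes p = p
  -- Equality of faces is not decidable here, so the case split is on heights; a failing inequality
  -- already refutes `x ≡ y`.
  ... | no ¬p = contradiction (<⇒≤ (height-mono-< (x⊑y , λ { refl → ¬p ≤-refl }))) ¬p

  height-Fmin : height Fmin ≡ 0
  height-Fmin = cong index rank-min

  height-Fmax : height Fmax ≡ suc N
  height-Fmax = cong index rank-max

  height≤ : ∀ x → height x ≤ suc N
  height≤ x = subst (height x ≤_) height-Fmax (height-mono-≤ (≤Fmax x))

  ⊏-height : ∀ {x y} → x ⊑ y → height x < height y → x ⊏ y
  ⊏-height x⊑y lt = x⊑y , λ { refl → <-irrefl refl lt }

-- Chains and flags of a finite polytope with decidable order.

record Enumeration {N : ℕ} (P : Polytope N) : Set where
  open Polytope P renaming (_≤_ to _⊑_)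
  field
    _≟_            : DecidableEquality Face
    _⊑?_           : ∀ x y → Dec (x ⊑ y)
    faces          : List Face
    faces-complete : ∀ x → x ∈ faces

module FinitePolytope {N : ℕ} (P : Polytope N) (enum : Enumeration P) where

  open Enumeration enum
  open Polytope P renaming (_≤_ to _⊑_; _<_ to _⊏_)
  open Heights P
  open IsPartialOrder isPO using ()
    renaming (refl to ⊑-refl; trans to ⊑-trans; antisym to ⊑-antisym)

  ⊑-same-height : ∀ {x y} → x ⊑ y → height y ≤ height x → x ≡ y
  ⊑-same-height {x} {y} x⊑y h with x ≟ y
  ... | yes eq = eq
  ... | no neq = contradiction h (<⇒≱ (height-mono-< (x⊑y , neq)))

  height-0 : ∀ {x} → height x ≡ 0 → x ≡ Fmin
  height-0 {x} h = sym (⊑-same-height (Fmin≤ x) (subst (_≤ height Fmin) (sym h) z≤n))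

  -- A flag as a set of faces instead of an indexed family; membership is what the rigidity argument
  -- asks about.
  record FullChain : Set₁ where
    field
      Member : Face → Set
      chain  : IsChain Member
      full   : ∀ {i} → i ≤ suc N → ∃[ x ] (Member x × height x ≡ i)

    member-⊑ : ∀ {x y} → Member x → Member y → height x ≤ height y → x ⊑ y
    member-⊑ {x} {y} mx my h with chain x y mx my
    ... | inj₁ x⊑y = x⊑y
    ... | inj₂ y⊑x with refl ← ⊑-same-height y⊑x h = ⊑-refl

    member-≡ : ∀ {x y} → Member x → Member y → height x ≡ height y → x ≡ y
    member-≡ mx my h = ⊑-same-height (member-⊑ mx my (≤-reflexive h)) (≤-reflexive (sym h))

  open FullChain

  height-face : ∀ Φ i → height (face Φ i) ≡ toℕ i
  height-face Φ i = height≡ (face-rank Φ i)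

  toFlag : FullChain → Flag
  toFlag C = record
    { face       = λ i → proj₁ (level i)
    ; face-rank  = λ i → rank≡ (proj₂ (proj₂ (level i)))
    ; face-chain = λ {i} {j} i≤j → member-⊑ C (proj₁ (proj₂ (level i))) (proj₁ (proj₂ (level j)))
        (subst₂ _≤_ (sym (proj₂ (proj₂ (level i)))) (sym (proj₂ (proj₂ (level j)))) i≤j)
    }
    where
    level : ∀ (i : Fin (suc (suc N))) → ∃[ x ] (Member C x × height x ≡ toℕ i)
    level i = full C (s≤s⁻¹ (toℕ<n i))

  toFlag-member : ∀ C i → Member C (face (toFlag C) i)
  toFlag-member C i = proj₁ (proj₂ (full C (s≤s⁻¹ (toℕ<n i))))

  incident? : ∀ x y → Dec (Incident x y)
  incident? x y = (x ⊑? y) ⊎-dec (y ⊑? x)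

  saturate : List Face → List Face → List Face
  saturate []       ys = ys
  saturate (z ∷ zs) ys with all? (incident? z) ys
  ... | yes _ = saturate zs (z ∷ ys)
  ... | no _  = saturate zs ys

  saturate-⊇ : ∀ zs {ys x} → x ∈ ys → x ∈ saturate zs ys
  saturate-⊇ []       x∈ = x∈
  saturate-⊇ (z ∷ zs) {ys} x∈ with all? (incident? z) ys
  ... | yes _ = saturate-⊇ zs (there x∈)
  ... | no _  = saturate-⊇ zs x∈

  ∷-chain : ∀ {z ys} → All (Incident z) ys → IsChain (_∈ ys) → IsChain (_∈ z ∷ ys)
  ∷-chain inc c x y (here refl) (here refl) = inj₁ ⊑-refl
  ∷-chain inc c x y (here refl) (there y∈)  = All.lookup inc y∈
  ∷-chain inc c x y (there x∈)  (here refl) = swap (All.lookup inc x∈)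
  ∷-chain inc c x y (there x∈)  (there y∈)  = c x y x∈ y∈

  saturate-chain : ∀ zs {ys} → IsChain (_∈ ys) → IsChain (_∈ saturate zs ys)
  saturate-chain []       c = c
  saturate-chain (z ∷ zs) {ys} c with all? (incident? z) ys
  ... | yes inc = saturate-chain zs (∷-chain inc c)
  ... | no _    = saturate-chain zs c

  -- A face rejected when its turn came was not incident with some face already chosen. That face
  -- stays in the result, so a face incident with the whole result cannot have been rejected.
  saturate-maximal : ∀ zs {ys z} → z ∈ zs → (∀ x → x ∈ saturate zs ys → Incident z x) →
                     z ∈ saturate zs ys
  saturate-maximal (z ∷ zs) {ys} z∈ inc with all? (incident? z) ys
  saturate-maximal (z ∷ zs)      (here refl) inc | yes _ = saturate-⊇ zs (here refl)
  saturate-maximal (z ∷ zs)      (here refl) inc | no ¬p =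
    contradiction (All.tabulate (λ x∈ → inc _ (saturate-⊇ zs x∈))) ¬p
  saturate-maximal (z ∷ zs)      (there z∈)  inc | yes _ = saturate-maximal zs z∈ inc
  saturate-maximal (z ∷ zs)      (there z∈)  inc | no _  = saturate-maximal zs z∈ inc

  extend-chain : ∀ xs → IsChain (_∈ xs) → Σ FullChain λ C → ∀ {x} → x ∈ xs → Member C x
  extend-chain xs c = record
    { Member = M
    ; chain  = saturate-chain faces c
    -- Saturation over the list of all faces yields a maximal chain, so gradedness supplies a face
    -- of every rank.
    ; full   = λ {i} i≤ → let (x , mx , rx) = graded M M-max (+ i - + 1)
                                    (minus-one-mono-≤ {0} {i} z≤n)
                                    (minus-one-mono-≤ {i} {suc N} i≤)
                          in x , mx , height≡ rx
    } , saturate-⊇ faces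
    where
    M : Face → Set
    M = _∈ saturate faces xs
    M-max : IsMaximalChain M
    M-max = saturate-chain faces c , λ z → saturate-maximal faces (faces-complete z)

  chain-through : ∀ {x y z} → x ⊑ y → y ⊑ z →
                  Σ FullChain λ C → Member C x × Member C y × Member C z
  chain-through {x} {y} {z} x⊑y y⊑z =
    let (C , m) = extend-chain (x ∷ y ∷ z ∷ [])
                    (∷-chain (inj₁ x⊑y ∷ inj₁ (⊑-trans x⊑y y⊑z) ∷ [])
                      (∷-chain (inj₁ y⊑z ∷ []) (∷-chain [] λ _ _ ())))
    in C , m (here refl) , m (there (here refl)) , m (there (there (here refl)))

  -- A flag through `E` and `G` has a face at each height, and within a flag the heights decide the
  -- order.
  interpolate : ∀ {E G i} → E ⊑ G → height E ≤ i → i ≤ height G →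
                ∃[ x ] (E ⊑ x × x ⊑ G × height x ≡ i)
  interpolate {E} {G} E⊑G E≤i i≤G =
    let (C , mE , _ , mG) = chain-through ⊑-refl E⊑G
        (x , mx , hx)     = full C (≤-trans i≤G (height≤ G))
    in x , member-⊑ C mE mx (subst (height E ≤_) (sym hx) E≤i)
         , member-⊑ C mx mG (subst (_≤ height G) (sym hx) i≤G)
         , hx

  rank-shift : ∀ k {x y} → height y ≡ k + height x → rank y ≡ rank x ℤ.+ + k
  rank-shift k {x} h = trans (rank≡ h)
    (trans (minus-one-shift k (height x)) (cong (ℤ._+ + k) (sym (rank-height x))))

  -- Sections of rank difference two.

  Middle : Face → Face → Face → Set
  Middle A B x = A ⊑ x × x ⊑ B × height x ≡ suc (height A)

  module _ {A B : Face} (A⊑B : A ⊑ B) (hB : height B ≡ 2 + height A) where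

    middle⇒between : ∀ {x} → Middle A B x → Between A B x
    middle⇒between (A⊑x , x⊑B , hx) =
      ⊏-height A⊑x (≤-reflexive (sym hx)) ,
      ⊏-height x⊑B (≤-reflexive (trans (cong suc hx) (sym hB)))

    between⇒middle : ∀ {x} → Between A B x → Middle A B x
    between⇒middle (A⊏x , x⊏B) = proj₁ A⊏x , proj₁ x⊏B ,
      ≤-antisym (s≤s⁻¹ (≤-trans (height-mono-< x⊏B) (≤-reflexive hB))) (height-mono-< A⊏x)

    A⊏B : A ⊏ B
    A⊏B = ⊏-height A⊑B (≤-trans (n≤1+n _) (≤-reflexive (sym hB)))

    middle-unique : ∀ {x y z} → Middle A B x → Middle A B y → Middle A B z →
                    x ≢ y → x ≢ z → y ≡ z
    middle-unique {x} {y} {z} mx my mz x≢y x≢z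
      with diamond A B A⊏B (rank-shift 2 hB)
    ... | H₁ , H₂ , _ , _ , _ , only
      with only x (middle⇒between mx) | only y (middle⇒between my) | only z (middle⇒between mz)
    ... | inj₁ refl | inj₁ refl | _         = contradiction refl x≢y
    ... | inj₁ refl | _         | inj₁ refl = contradiction refl x≢z
    ... | inj₁ _    | inj₂ refl | inj₂ refl = refl
    ... | inj₂ refl | inj₂ refl | _         = contradiction refl x≢y
    ... | inj₂ refl | _         | inj₂ refl = contradiction refl x≢z
    ... | inj₂ _    | inj₁ refl | inj₁ refl = refl

    middle-other : ∀ x → ∃[ y ] (Middle A B y × x ≢ y)
    middle-other x with diamond A B A⊏B (rank-shift 2 hB)
    ... | H₁ , H₂ , b₁ , b₂ , H₁≢H₂ , _ with x ≟ H₁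
    ... | yes refl = H₂ , between⇒middle b₂ , H₁≢H₂
    ... | no x≢H₁  = H₁ , between⇒middle b₁ , x≢H₁

  -- Connectivity of coatoms through ridges.

  Coatom : Face → Face → Face → Set
  Coatom E G F = E ⊑ F × F ⊑ G × height G ≡ suc (height F)

  coatom-above : ∀ {E G} → E ⊏ G → ∃[ F ] Coatom E G F
  coatom-above {E} {G} E⊏G with height G in hG | height-mono-< E⊏G
  ... | suc k | s≤s E≤k =
    let (F , E⊑F , F⊑G , hF) = interpolate (proj₁ E⊏G) E≤k
                                 (subst (k ≤_) (sym hG) (n≤1+n k))
    in F , E⊑F , F⊑G , cong suc (sym hF)

  -- `F₁` and `F₂` are facets of a section with top `G`, and `R` is a ridge common to both.
  RidgeInvariant : Face → Face → (Face → Set) → Set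
  RidgeInvariant E G Q = ∀ {R F₁ F₂} → E ⊑ R → R ⊑ F₁ → R ⊑ F₂ → F₁ ⊑ G → F₂ ⊑ G →
    height F₁ ≡ suc (height R) → height F₂ ≡ suc (height R) → height G ≡ 2 + height R →
    Q F₁ → Q F₂

  coatom-unique : ∀ {F G F'} → height G ≡ suc (height F) → Coatom F G F' → F ≡ F'
  coatom-unique hF (F⊑F' , _ , hF') =
    ⊑-same-height F⊑F' (≤-reflexive (suc-injective (trans (sym hF') hF)))

  -- Strong connectivity only links faces of arbitrary rank. Such a path is refined to a path of
  -- coatoms in which neighbours share a ridge, by induction on a bound `d` for the height
  -- difference.
  coatoms-connected : ∀ d {E G} {Q : Face → Set} → height G ≤ d + height E →
                      RidgeInvariant E G Q →
                      ∀ {F₁ F₂} → Coatom E G F₁ → Coatom E G F₂ → Q F₁ → Q F₂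
  coatoms-connected zero b inv (E⊑F , _ , hF) _ _ =
    contradiction (height-mono-≤ E⊑F) (<⇒≱ (subst (_≤ _) hF b))
  coatoms-connected (suc d) {E} {G} {Q} b inv {F₁} {F₂}
    c₁@(E⊑F₁ , F₁⊑G , h₁) c₂@(E⊑F₂ , F₂⊑G , h₂) q
    with F₁ ≟ F₂ | 3 + height E ≤? height G
  ... | yes refl | _ = q
  -- The height difference is exactly two here, so `E` itself is the common ridge.
  ... | no F₁≢F₂ | no small = inv ⊑-refl E⊑F₁ E⊑F₂ F₁⊑G F₂⊑G
          (suc-injective (trans (sym h₁) hG)) (suc-injective (trans (sym h₂) hG)) hG q
    where
    E≢F₁ : E ≢ F₁
    E≢F₁ refl = F₁≢F₂ (coatom-unique h₁ c₂)
    hG : height G ≡ 2 + height E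
    hG = ≤-antisym (s≤s⁻¹ (≰⇒> small))
           (subst (2 + height E ≤_) (sym h₁) (s≤s (height-mono-< (E⊑F₁ , E≢F₁))))
  ... | no _ | yes large = walk
          (strongly-connected E G (⊏-height (⊑-trans E⊑F₁ F₁⊑G) (≤-trans (s≤s (m≤n+m _ 2)) large))
            large-rank F₁ F₂ (between c₁) (between c₂))
          -- The walk carries `Q` for all coatoms above the current face; above `F₁` the only one is
          -- `F₁`.
          (λ c → subst Q (coatom-unique h₁ c) q) (⊑-refl , F₂⊑G , h₂)
    where
    large-rank : rank E ℤ.+ + 3 ℤ.≤ rank G
    large-rank = subst₂ ℤ._≤_
      (trans (minus-one-shift 3 (height E)) (cong (ℤ._+ + 3) (sym (rank-height E))))
      (sym (rank-height G)) (minus-one-mono-≤ large)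

    between : ∀ {F} → Coatom E G F → Between E G F
    between (E⊑F , F⊑G , hF) =
      ⊏-height E⊑F (s≤s⁻¹ (≤-trans (n≤1+n _) (subst (3 + height E ≤_) hF large))) ,
      ⊏-height F⊑G (≤-reflexive (sym hF))

    -- On a downward link from H to H₂, the coatoms above H₂ are reached from one
    -- above H by recursion in the shorter interval [H₂ , G].
    walk : ∀ {H H'} → Star (LinkIn E G) H H' →
           (∀ {F} → Coatom H G F → Q F) → ∀ {F} → Coatom H' G F → Q F
    walk ε qH = qH
    walk ((_ , _ , inj₁ H⊑H₂) ◅ rest) qH =
      walk rest λ { (H₂⊑F , c) → qH (⊑-trans H⊑H₂ H₂⊑F , c) }
    walk {H} (_◅_ {j = H₂} ((E⊏H , H⊏G) , (E⊏H₂ , _) , inj₂ H₂⊑H) rest) qH =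
      walk rest λ c →
        let (F , H⊑F , cF) = coatom-above H⊏G
        in coatoms-connected d
             (≤-trans b (≤-trans (≤-reflexive (sym (+-suc d (height E))))
                                 (+-monoʳ-≤ d (height-mono-< E⊏H₂))))
             (λ H₂⊑R → inv (⊑-trans (proj₁ E⊏H₂) H₂⊑R))
             (⊑-trans H₂⊑H H⊑F , cF) c (qH (H⊑F , cF))

  -- Embeddings and rigidity.

  -- Conditions are imposed only below `G`; elsewhere the total map `f` is arbitrary, which avoids a
  -- separate type of faces below `G`.
  record Embedding (G : Face) (f : Face → Face) : Set where
    field
      mono            : ∀ {x y} → x ⊑ y → y ⊑ G → f x ⊑ f y
      injective       : ∀ {x y} → x ⊑ G → y ⊑ G → f x ≡ f y → x ≡ y
      height-preserve : ∀ {x} → x ⊑ G → height (f x) ≡ height x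

  open Embedding

  restrict : ∀ {F G f} → F ⊑ G → Embedding G f → Embedding F f
  restrict F⊑G ef = record
    { mono            = λ x⊑y y⊑F → mono ef x⊑y (⊑-trans y⊑F F⊑G)
    ; injective       = λ x⊑F y⊑F → injective ef (⊑-trans x⊑F F⊑G) (⊑-trans y⊑F F⊑G)
    ; height-preserve = λ x⊑F → height-preserve ef (⊑-trans x⊑F F⊑G)
    }

  id-embedding : ∀ {G} → Embedding G id
  id-embedding = record
    { mono = λ x⊑y _ → x⊑y ; injective = λ _ _ → id ; height-preserve = λ _ → refl }

  ∘-embedding : ∀ {F G f g} → Embedding F f → Embedding G g → g G ≡ F → Embedding G (f ∘ g)
  ∘-embedding {F} {G} {f} {g} ef eg gG = record
    { mono            = λ x⊑y y⊑G → mono ef (mono eg x⊑y y⊑G) (below y⊑G)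
    ; injective       = λ x⊑G y⊑G → injective eg x⊑G y⊑G ∘ injective ef (below x⊑G) (below y⊑G)
    ; height-preserve = λ x⊑G → trans (height-preserve ef (below x⊑G)) (height-preserve eg x⊑G)
    }
    where
    below : ∀ {x} → x ⊑ G → g x ⊑ F
    below x⊑G = subst (g _ ⊑_) gG (mono eg x⊑G ⊑-refl)

  -- Induction on the bound `d`. The coatom lying on the flag is settled by the shorter case.
  -- Agreement then passes across a ridge `R`: the diamond above `R` determines the value at the
  -- next coatom, and a new flag through `R` makes the shorter case available again. Connectivity
  -- reaches a coatom above `x`.
  rigid : ∀ d {E G f g} → height G ≤ d + height E → Embedding G f → Embedding G g →
          (C : FullChain) → Member C E → Member C G →
          (∀ {x} → Member C x → E ⊑ x → x ⊑ G → f x ≡ g x) →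
          ∀ {x} → E ⊑ x → x ⊑ G → f x ≡ g x
  rigid d {E} {G} {f} {g} b ef eg C mE mG agree {x} E⊑x x⊑G with x ≟ G
  ... | yes refl = agree mG E⊑x x⊑G
  ... | no x≢G = go d b
    where
    E⊏G : E ⊏ G
    E⊏G = ⊏-height (⊑-trans E⊑x x⊑G) (≤-<-trans (height-mono-≤ E⊑x) (height-mono-< (x⊑G , x≢G)))

    fG≡gG : f G ≡ g G
    fG≡gG = agree mG (proj₁ E⊏G) ⊑-refl

    go : ∀ d → height G ≤ d + height E → f x ≡ g x
    go zero    b = contradiction b (<⇒≱ (height-mono-< E⊏G))
    go (suc d) b =
      let (k , hG)         = height-suc
          (F₀ , mF₀ , hF₀) = full C (≤-trans (n≤1+n k) (subst (_≤ suc N) hG (height≤ G)))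
          hG₀              = trans hG (cong suc (sym hF₀))
          F₀⊑G             = member-⊑ C mF₀ mG (subst (height F₀ ≤_) (sym hG₀) (n≤1+n _))
          E⊑F₀             = member-⊑ C mE mF₀
                               (s≤s⁻¹ (subst (suc (height E) ≤_) hG₀ (height-mono-< E⊏G)))
          (F , x⊑F , cF)   = coatom-above (x⊑G , x≢G)
          agree₀           = rigid d (s≤s⁻¹ (subst (_≤ suc d + height E) hG₀ b))
                               (restrict F₀⊑G ef) (restrict F₀⊑G eg) C mE mF₀
                               (λ my E⊑y y⊑F₀ → agree my E⊑y (⊑-trans y⊑F₀ F₀⊑G))
      in coatoms-connected (suc d) b step
           (E⊑F₀ , F₀⊑G , hG₀) (⊑-trans E⊑x x⊑F , cF) agree₀ E⊑x x⊑F
      where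
      height-suc : ∃[ k ] height G ≡ suc k
      height-suc with height G | height-mono-< E⊏G
      ... | suc k | _ = k , refl

      Agree : Face → Set
      Agree F = ∀ {y} → E ⊑ y → y ⊑ F → f y ≡ g y

      step : RidgeInvariant E G Agree
      step {R} {F₁} {F₂} E⊑R R⊑F₁ R⊑F₂ F₁⊑G F₂⊑G h₁ h₂ hG agree₁ with F₁ ≟ F₂
      ... | yes refl = agree₁
      ... | no F₁≢F₂ =
        let (C' , mE' , mR' , mF') = chain-through E⊑R R⊑F₂
        in rigid d (s≤s⁻¹ (subst (_≤ suc d + height E) (trans hG (cong suc (sym h₂))) b))
             (restrict F₂⊑G ef) (restrict F₂⊑G eg) C' mE' mF' (agree' C' mR')
        where
        R⊑G = ⊑-trans R⊑F₁ F₁⊑G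

        middle : ∀ {h F} → Embedding G h → R ⊑ F → F ⊑ G → height F ≡ suc (height R) →
                 Middle (h R) (h G) (h F)
        middle eh R⊑F F⊑G hF = mono eh R⊑F F⊑G , mono eh F⊑G ⊑-refl ,
          trans (height-preserve eh F⊑G) (trans hF (cong suc (sym (height-preserve eh R⊑G))))

        fF₁≡gF₁ : f F₁ ≡ g F₁
        fF₁≡gF₁ = agree₁ (⊑-trans E⊑R R⊑F₁) ⊑-refl

        -- The section from `f R` to `f G` has two middle faces, and by injectivity `f F₂` and
        -- `g F₂` both differ from `f F₁`.
        fF₂≡gF₂ : f F₂ ≡ g F₂
        fF₂≡gF₂ = middle-unique (mono ef R⊑G ⊑-refl)
          (trans (height-preserve ef ⊑-refl)
            (trans hG (cong (λ i → 2 + i) (sym (height-preserve ef R⊑G)))))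
          (middle ef R⊑F₁ F₁⊑G h₁) (middle ef R⊑F₂ F₂⊑G h₂)
          (subst₂ (λ A B → Middle A B (g F₂)) (sym (agree₁ E⊑R R⊑F₁)) (sym fG≡gG)
            (middle eg R⊑F₂ F₂⊑G h₂))
          (F₁≢F₂ ∘ injective ef F₁⊑G F₂⊑G)
          (F₁≢F₂ ∘ injective eg F₁⊑G F₂⊑G ∘ trans (sym fF₁≡gF₁))

        agree' : ∀ C' → Member C' R → ∀ {y} → Member C' y → E ⊑ y → y ⊑ F₂ → f y ≡ g y
        agree' C' mR {y} my E⊑y y⊑F₂ with y ≟ F₂
        ... | yes refl = fF₂≡gF₂
        -- A face of this flag strictly below `F₂` has at most the height of `R`, so it lies below
        -- `R` and therefore below `F₁`.
        ... | no y≢F₂  = agree₁ E⊑y (⊑-trans (member-⊑ C' my mR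
                (s≤s⁻¹ (subst (height y <_) h₂ (height-mono-< (y⊑F₂ , y≢F₂))))) R⊑F₁)

-- Facets as copies of `K`.

module Facet {n : ℕ} (P : Polytope (suc n)) (enum : Enumeration P) (K : Polytope n)
  {F : Polytope.Face P} (hF : Heights.height P F ≡ suc n) (iso : FacetIso P F K) where

  open Enumeration enum
  open Polytope P using (Face; Fmin≤; isPO; Flag; face; face-chain)
    renaming (_≤_ to _⊑_; _<_ to _⊏_)
  open Heights P
  open FinitePolytope P enum
  open IsPartialOrder isPO using ()
    renaming (refl to ⊑-refl; trans to ⊑-trans; antisym to ⊑-antisym)
  open FacetIso iso
  module K  = Polytope K
  module KH = Heights K
  module KPO = IsPartialOrder K.isPO

  -- `to` takes a proof of the order relation as an argument, and such proofs need not be unique;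
  -- antisymmetry in `K` identifies the values.
  to-irrelevant : ∀ {x} (p q : x ⊑ F) → to x p ≡ to x q
  to-irrelevant p q = KPO.antisym (to-mono _ _ p q ⊑-refl) (to-mono _ _ q p ⊑-refl)

  to-mono-⊏ : ∀ {x y} (p : x ⊑ F) (q : y ⊑ F) → x ⊏ y → to x p K.< to y q
  to-mono-⊏ p q (x⊑y , x≢y) = to-mono _ _ p q x⊑y ,
    λ eq → x≢y (trans (sym (from-to _ p)) (trans (cong from eq) (from-to _ q)))

  -- `FacetIso` speaks of order only, so ranks have to be recovered. Descending from `x` one height
  -- at a time gives a strict chain whose image forces the image of `x` to be high enough.
  height≤to-height : ∀ i {x} (p : x ⊑ F) → height x ≡ i → i ≤ KH.height (to x p)
  height≤to-height zero    _ _  = z≤n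
  height≤to-height (suc i) {x} p hx =
    let (y , _ , y⊑x , hy) = interpolate (Fmin≤ x)
                               (subst (_≤ i) (sym height-Fmin) z≤n)
                               (subst (i ≤_) (sym hx) (n≤1+n i))
        q                  = ⊑-trans y⊑x p
    in ≤-<-trans (height≤to-height i q hy) (KH.height-mono-< (to-mono-⊏ q p
         (⊏-height y⊑x (≤-reflexive (trans (cong suc hy) (sym hx))))))

  -- The opposite bound: `j` strict steps lead from `x` up to `F`, and their images must fit below
  -- the top of `K`.
  to-height≤height : ∀ j {x} (p : x ⊑ F) → j + height x ≡ suc n →
                     j + KH.height (to x p) ≤ suc n
  to-height≤height zero    p _ = KH.height≤ _
  to-height≤height (suc j) {x} p eq =
    let (y , x⊑y , y⊑F , hy) = interpolate p (n≤1+n (height x))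
                                 (subst (suc (height x) ≤_) (trans eq (sym hF))
                                   (s≤s (m≤n+m (height x) j)))
    in ≤-trans (≤-trans (≤-reflexive (sym (+-suc j _)))
                 (+-monoʳ-≤ j (KH.height-mono-< (to-mono-⊏ p y⊑F
                   (⊏-height x⊑y (≤-reflexive (sym hy)))))))
         (to-height≤height j y⊑F
           (trans (cong (λ k → j + k) hy) (trans (+-suc j (height x)) eq)))

  to-height : ∀ {x} (p : x ⊑ F) → KH.height (to x p) ≡ height x
  to-height {x} p =
    let j    = suc n ∸ height x
        j+x≡ = m∸n+n≡m (subst (height x ≤_) hF (height-mono-≤ p))
    in ≤-antisym
         (+-cancelˡ-≤ j _ _ (≤-trans (to-height≤height j p j+x≡) (≤-reflexive (sym j+x≡))))
         (height≤to-height (height x) p refl)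

  from-height : ∀ y → height (from y) ≡ KH.height y
  from-height y = trans (sym (to-height (from≤ y))) (cong KH.height (to-from y))

  from-mono : ∀ {x y} → x K.≤ y → from x ⊑ from y
  from-mono {x} {y} x≤y = to-refl _ _ (from≤ x) (from≤ y)
    (subst₂ K._≤_ (sym (to-from x)) (sym (to-from y)) x≤y)

  flat : K.IsFlat (+ 1) (+ n - + 1) → 3 ≤ n →
         ∀ {x R} → x ⊑ F → R ⊑ F → height x ≡ 2 → height R ≡ n → x ⊑ R
  flat K-flat 3≤n {x} {R} x⊑F R⊑F hx hR
    with K-flat (to x x⊑F) (to R R⊑F)
           (KH.rank≡ (trans (to-height x⊑F) hx)) (KH.rank≡ (trans (to-height R⊑F) hR))
  ... | inj₁ le = to-refl _ _ x⊑F R⊑F le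
  -- The reverse incidence would put a face of height `n` below one of height 2, against `3 ≤ n`.
  ... | inj₂ le = contradiction (height-mono-≤ (to-refl _ _ R⊑F x⊑F le))
                    (<⇒≱ (subst₂ _<_ (sym hx) (sym hR) 3≤n))

  conjugate : K.Automorphism → Face → Face
  conjugate κ x with x ⊑? F
  ... | yes p = from (K.to κ (to x p))
  -- A default value outside the facet.
  ... | no _  = x

  module _ (κ : K.Automorphism) where

    conjugate-spec : ∀ {x} (p : x ⊑ F) → conjugate κ x ≡ from (K.to κ (to x p))
    conjugate-spec {x} p with x ⊑? F
    ... | yes q = cong (from ∘ K.to κ) (to-irrelevant q p)
    ... | no ¬p = contradiction p ¬p

    conjugate-embedding : Embedding F (conjugate κ)
    conjugate-embedding = record
      { mono = λ {x} {y} x⊑y y⊑F → let x⊑F = ⊑-trans x⊑y y⊑F in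
          subst₂ _⊑_ (sym (conjugate-spec x⊑F)) (sym (conjugate-spec y⊑F))
            (from-mono (K.to-mono κ (to-mono x y x⊑F y⊑F x⊑y)))
      ; injective = λ {x} {y} p q eq →
          ⊑-antisym (reflects p q eq) (reflects q p (sym eq))
      ; height-preserve = λ p → trans (cong height (conjugate-spec p))
          (trans (from-height _) (trans (cong index (K.to-rank κ _)) (to-height p)))
      }
      where
      reflects : ∀ {x y} → x ⊑ F → y ⊑ F → conjugate κ x ≡ conjugate κ y → x ⊑ y
      reflects {x} {y} p q eq = to-refl _ _ p q (K.to-refl κ
        (subst₂ K._≤_ (to-from _) (to-from _)
          (to-mono _ _ (from≤ _) (from≤ _) (subst₂ _⊑_ (conjugate-spec p) (conjugate-spec q)
            (subst (conjugate κ x ⊑_) eq ⊑-refl)))))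

  toFacetFlag : (Φ : Flag) → (∀ i → face Φ (inject₁ i) ⊑ F) → K.Flag
  toFacetFlag Φ below = record
    { face       = λ i → to (face Φ (inject₁ i)) (below i)
    ; face-rank  = λ i → KH.rank≡ (trans (to-height (below i))
                           (trans (height-face Φ (inject₁ i)) (toℕ-inject₁ i)))
    ; face-chain = λ {i} {j} i≤j → to-mono _ _ (below i) (below j)
        (face-chain Φ (subst₂ _≤_ (sym (toℕ-inject₁ i)) (sym (toℕ-inject₁ j)) i≤j))
    }

  -- Without their last faces, which `inject₁` omits, both flags become flags of `K`, and regularity
  -- of `K` provides the automorphism to conjugate.
  extend-flag-map : K.IsRegular → (Φ Ψ : Flag) →
    (∀ i → face Φ (inject₁ i) ⊑ F) → (∀ i → face Ψ (inject₁ i) ⊑ F) →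
    ∃[ f ] (Embedding F f × (∀ i → f (face Φ (inject₁ i)) ≡ face Ψ (inject₁ i)))
  extend-flag-map K-regular Φ Ψ Φ⊑F Ψ⊑F =
    let (κ , κΦ≡Ψ) = K-regular (toFacetFlag Φ Φ⊑F) (toFacetFlag Ψ Ψ⊑F)
    in conjugate κ , conjugate-embedding κ , λ i →
         trans (conjugate-spec κ (Φ⊑F i)) (trans (cong from (κΦ≡Ψ i)) (from-to _ (Ψ⊑F i)))

-- The base edge lies in every facet.

module Gluing {n : ℕ} (3≤n : 3 ≤ n) (K : Polytope n) (K-regular : IsRegular K)
  (K-flat : IsFlat K (+ 1) (+ n - + 1)) (P : Polytope (suc n)) (enum : Enumeration P)
  (facets : HasFacets P K) (Φ₀ : Polytope.Flag P) where

  open Enumeration enum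
  open Polytope P renaming (_≤_ to _⊑_; _<_ to _⊏_)
  open Heights P
  open FinitePolytope P enum
  open FullChain
  open Embedding
  open IsPartialOrder isPO using ()
    renaming (refl to ⊑-refl; trans to ⊑-trans; antisym to ⊑-antisym)

  -- Flag indices are heights, one above the rank: vertex at 1, edge at 2, facet at `suc n`.
  v e F₀ : Face
  v  = face Φ₀ (suc zero)
  e  = face Φ₀ (suc (suc zero))
  F₀ = face Φ₀ (inject₁ (fromℕ< (n<1+n (suc n))))

  v-height : height v ≡ 1
  v-height = height-face Φ₀ (suc zero)

  e-height : height e ≡ 2
  e-height = height-face Φ₀ (suc (suc zero))

  v⊑e : v ⊑ e
  v⊑e = face-chain Φ₀ {suc zero} {suc (suc zero)} (s≤s z≤n)

  F₀-height : height F₀ ≡ suc n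
  F₀-height = trans (height-face Φ₀ _) (trans (toℕ-inject₁ _) (toℕ-fromℕ< (n<1+n (suc n))))

  Facet : Face → Set
  Facet F = height F ≡ suc n

  facet-iso : ∀ {F} → Facet F → FacetIso P F K
  facet-iso hF = facets _ (rank≡ hF)

  facet-coatom : ∀ {x F} → x ⊑ F → Facet F → Coatom x Fmax F
  facet-coatom x⊑F hF = x⊑F , ≤Fmax _ , trans height-Fmax (cong suc (sym hF))

  coatom-facet : ∀ {F} → height Fmax ≡ suc (height F) → Facet F
  coatom-facet h = suc-injective (trans (sym h) height-Fmax)

  e⊑ridge : ∀ {F R} → Facet F → e ⊑ F → R ⊑ F → height R ≡ n → e ⊑ R
  e⊑ridge hF e⊑F R⊑F hR = Facet.flat P enum K hF (facet-iso hF) K-flat 3≤n e⊑F R⊑F e-height hR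

  ridge-height : ∀ {F R} → Facet F → height F ≡ suc (height R) → height R ≡ n
  ridge-height hF h = suc-injective (trans (sym h) hF)

  top-bound : ∀ x → height Fmax ≤ suc (suc n) + height x
  top-bound x = ≤-trans (≤-reflexive height-Fmax) (m≤m+n (suc (suc n)) (height x))

  -- Flatness puts `e` below every ridge of a facet that contains it, hence below each facet across
  -- such a ridge; connectivity starts from `F₀`.
  e⊑facet : ∀ {F} → Facet F → e ⊑ F
  e⊑facet hF = coatoms-connected (suc (suc n)) (top-bound Fmin) step
    (facet-coatom (Fmin≤ F₀) F₀-height) (facet-coatom (Fmin≤ _) hF)
    (face-chain Φ₀ (subst (2 ≤_) (sym (trans (toℕ-inject₁ _) (toℕ-fromℕ< (n<1+n (suc n)))))
      (≤-trans (≤-trans (n≤1+n 2) 3≤n) (n≤1+n n))))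
    where
    step : RidgeInvariant Fmin Fmax (e ⊑_)
    step _ R⊑F₁ R⊑F₂ _ _ h₁ _ hmax e⊑F₁ =
      let hF₁ = coatom-facet (trans hmax (cong suc (sym h₁)))
      in ⊑-trans (e⊑ridge hF₁ e⊑F₁ R⊑F₁ (ridge-height hF₁ h₁)) R⊑F₂

  -- Exchanging the vertex of a flag on the edge.

  e-diamond : height e ≡ 2 + height Fmin
  e-diamond = trans e-height (cong (λ i → 2 + i) (sym height-Fmin))

  other-vertex : ∃[ w ] (Middle Fmin e w × v ≢ w)
  other-vertex = middle-other (Fmin≤ e) e-diamond v

  v' : Face
  v' = proj₁ other-vertex

  v'-middle : Middle Fmin e v'
  v'-middle = proj₁ (proj₂ other-vertex)

  v≢v' : v ≢ v'
  v≢v' = proj₂ (proj₂ other-vertex)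

  v'⊑e : v' ⊑ e
  v'⊑e = proj₁ (proj₂ v'-middle)

  v'-height : height v' ≡ 1
  v'-height = trans (proj₂ (proj₂ v'-middle)) (cong suc height-Fmin)

  v-middle : Middle Fmin e v
  v-middle = Fmin≤ v , v⊑e , trans v-height (cong suc (sym height-Fmin))

  -- The result is still a chain because all later faces lie above `e`, and so above `v'`.
  swap-vertex : (Φ : Flag) → face Φ (suc (suc zero)) ≡ e → Flag
  swap-vertex Φ Φ₂≡e = record { face = face' ; face-rank = rank' ; face-chain = chain' }
    where
    face' : Fin (suc (suc (suc n))) → Face
    face' (suc zero) = v'
    face' i          = face Φ i

    rank' : ∀ i → rank (face' i) ≡ + toℕ i - + 1
    rank' zero          = face-rank Φ zero
    rank' (suc zero)    = rank≡ v'-height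
    rank' (suc (suc i)) = face-rank Φ (suc (suc i))

    chain' : ∀ {i j} → toℕ i ≤ toℕ j → face' i ⊑ face' j
    chain' {zero}        {zero}        i≤j = face-chain Φ i≤j
    chain' {zero}        {suc zero}    _   =
      subst (_⊑ v') (sym (height-0 (height-face Φ zero))) (Fmin≤ v')
    chain' {zero}        {suc (suc j)} i≤j = face-chain Φ i≤j
    chain' {suc zero}    {suc zero}    _   = ⊑-refl
    chain' {suc zero}    {suc (suc j)} _   = ⊑-trans v'⊑e
      (subst (_⊑ face Φ (suc (suc j))) Φ₂≡e (face-chain Φ (s≤s (s≤s z≤n))))
    chain' {suc (suc i)} {suc (suc j)} i≤j = face-chain Φ i≤j
    chain' {suc zero}    {zero}        ()
    chain' {suc (suc i)} {zero}        ()
    chain' {suc (suc i)} {suc zero}    (s≤s ())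

  -- Reflections of single facets.

  record Reflection (F : Face) : Set where
    field
      apply     : Face → Face
      embedding : Embedding F apply
      vertex    : apply v ≡ v'
      above     : ∀ {x} → e ⊑ x → x ⊑ F → apply x ≡ x

  open Reflection

  -- Regularity of `K` moves a flag through `v`, `e` and `F` to the one with `v'` in place of `v`.
  -- The map fixes the flag from `e` upwards, and rigidity against the identity extends this to all
  -- faces between `e` and `F`.
  reflection : ∀ {F} → Facet F → Reflection F
  reflection {F} hF = record
    { apply     = f
    ; embedding = f-embedding
    ; vertex    = f-vertex
    ; above     = rigid (height F) (m≤m+n _ _) f-embedding id-embedding C mE mF f-above
    }
    where
    e⊑F : e ⊑ F
    e⊑F = e⊑facet hF

    through : Σ FullChain λ C → Member C v × Member C e × Member C F
    through = chain-through v⊑e e⊑F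

    C  = proj₁ through
    mV = proj₁ (proj₂ through)
    mE = proj₁ (proj₂ (proj₂ through))
    mF = proj₂ (proj₂ (proj₂ through))

    Φ : Flag
    Φ = toFlag C

    Φ-at : ∀ {x} i → Member C x → height x ≡ toℕ i → face Φ i ≡ x
    Φ-at i mx hx = member-≡ C (toFlag-member C i) mx (trans (height-face Φ i) (sym hx))

    Ψ : Flag
    Ψ = swap-vertex Φ (Φ-at (suc (suc zero)) mE e-height)

    Φ⊑F : ∀ i → face Φ (inject₁ i) ⊑ F
    Φ⊑F i = member-⊑ C (toFlag-member C (inject₁ i)) mF
      (subst₂ _≤_ (sym (trans (height-face Φ (inject₁ i)) (toℕ-inject₁ i))) (sym hF)
        (s≤s⁻¹ (toℕ<n i)))

    Ψ⊑F : ∀ i → face Ψ (inject₁ i) ⊑ F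
    Ψ⊑F zero          = Φ⊑F zero
    Ψ⊑F (suc zero)    = ⊑-trans v'⊑e e⊑F
    Ψ⊑F (suc (suc i)) = Φ⊑F (suc (suc i))

    extension = Facet.extend-flag-map P enum K hF (facet-iso hF) K-regular Φ Ψ Φ⊑F Ψ⊑F
    f           = proj₁ extension
    f-embedding = proj₁ (proj₂ extension)
    fΦ≡Ψ        = proj₂ (proj₂ extension)

    f-vertex : f v ≡ v'
    f-vertex = trans (cong f (sym (Φ-at (suc zero) mV v-height))) (fΦ≡Ψ (suc zero))

    f-Φ : ∀ i → 2 ≤ toℕ i → f (face Φ (inject₁ i)) ≡ face Φ (inject₁ i)
    f-Φ (suc zero)    (s≤s ())
    -- From index 2 on, `Ψ` and `Φ` have the same faces by definition.
    f-Φ (suc (suc i)) _ = fΦ≡Ψ (suc (suc i))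

    f-above : ∀ {x} → Member C x → e ⊑ x → x ⊑ F → f x ≡ x
    f-above {x} mx e⊑x x⊑F =
      let x<    = s≤s (subst (height x ≤_) hF (height-mono-≤ x⊑F))
          i     = fromℕ< x<
          hi    = toℕ-fromℕ< x<
          Φi≡x  = Φ-at (inject₁ i) mx (sym (trans (toℕ-inject₁ i) hi))
      in subst (λ y → f y ≡ y) Φi≡x
           (f-Φ i (subst (2 ≤_) (sym hi) (subst (_≤ height x) e-height (height-mono-≤ e⊑x))))

  -- Uniqueness and consistency of the reflections.

  -- On a flag through `v`, `e` and `G` the maps agree: at height 0 both values are `Fmin`, at
  -- height 1 the face is `v`, and the rest lies above `e`. Rigidity does the rest.
  agree-below : ∀ {G f g} → e ⊑ G → Embedding G f → Embedding G g → f v ≡ g v →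
                (∀ {x} → e ⊑ x → x ⊑ G → f x ≡ g x) → ∀ {x} → x ⊑ G → f x ≡ g x
  agree-below {G} {f} {g} e⊑G ef eg fv≡gv above-e =
    let (C , mV , mE , mG) = chain-through v⊑e e⊑G
        (x₀ , m₀ , h₀)     = full C {0} z≤n
    in rigid (height G) (m≤m+n _ _) ef eg C (subst (Member C) (height-0 h₀) m₀) mG
         (agree C mV mE) (Fmin≤ _)
    where
    agree : ∀ C → Member C v → Member C e → ∀ {x} → Member C x → Fmin ⊑ x → x ⊑ G → f x ≡ g x
    agree C mV mE {x} mx _ x⊑G with height x in hx
    ... | 0 with refl ← height-0 hx =
      trans (height-0 (trans (height-preserve ef x⊑G) height-Fmin))
        (sym (height-0 (trans (height-preserve eg x⊑G) height-Fmin)))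
    ... | 1 with refl ← member-≡ C mx mV (trans hx (sym v-height)) = fv≡gv
    ... | suc (suc k) = above-e (member-⊑ C mE mx
            (subst₂ _≤_ (sym e-height) (sym hx) (s≤s (s≤s z≤n)))) x⊑G

  reflections-agree : ∀ {G F₁ F₂} → e ⊑ G → G ⊑ F₁ → G ⊑ F₂ →
                      (r₁ : Reflection F₁) (r₂ : Reflection F₂) →
                      ∀ {x} → x ⊑ G → apply r₁ x ≡ apply r₂ x
  reflections-agree e⊑G G⊑F₁ G⊑F₂ r₁ r₂ =
    agree-below e⊑G (restrict G⊑F₁ (embedding r₁)) (restrict G⊑F₂ (embedding r₂))
      (trans (vertex r₁) (sym (vertex r₂)))
      (λ e⊑x x⊑G → trans (above r₁ e⊑x (⊑-trans x⊑G G⊑F₁))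
                     (sym (above r₂ e⊑x (⊑-trans x⊑G G⊑F₂))))

  apply-⊑ : ∀ {F} → Facet F → (r : Reflection F) → ∀ {x} → x ⊑ F → apply r x ⊑ F
  apply-⊑ hF r {x} x⊑F = subst (apply r x ⊑_) (above r (e⊑facet hF) ⊑-refl)
                           (mono (embedding r) x⊑F ⊑-refl)

  reflection-involutive : ∀ {F} → Facet F → (r : Reflection F) →
                          ∀ {x} → x ⊑ F → apply r (apply r x) ≡ x
  reflection-involutive {F} hF r =
    agree-below e⊑F (∘-embedding (embedding r) (embedding r) (above r e⊑F ⊑-refl)) id-embedding
      (trans (cong (apply r) (vertex r)) v'↦v)
      (λ e⊑x x⊑F → trans (cong (apply r) (above r e⊑x x⊑F)) (above r e⊑x x⊑F))
    where
    e⊑F : e ⊑ F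
    e⊑F = e⊑facet hF

    v'⊑F : v' ⊑ F
    v'⊑F = ⊑-trans v'⊑e e⊑F

    v'-image-middle : Middle Fmin e (apply r v')
    v'-image-middle = Fmin≤ _ ,
      subst (apply r v' ⊑_) (above r ⊑-refl e⊑F) (mono (embedding r) v'⊑e e⊑F) ,
      trans (height-preserve (embedding r) v'⊑F) (proj₂ (proj₂ v'-middle))

    v'↦v : apply r v' ≡ v
    -- By injectivity `apply r v'` differs from `apply r v`, which is `v'`; the only other vertex of
    -- `e` is `v`.
    v'↦v = middle-unique (Fmin≤ e) e-diamond v'-middle v'-image-middle v-middle
      (λ eq → v≢v' (injective (embedding r) (⊑-trans v⊑e e⊑F) v'⊑F (trans (vertex r) eq)))
      (v≢v' ∘ sym)

  -- The facets above `x` are connected through ridges above `x`. Each such ridge contains `e`, so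
  -- the two reflections meeting there agree below it, in particular at `x`.
  reflection-consistent : ∀ {x F₁ F₂} (h₁ : Facet F₁) (h₂ : Facet F₂) → x ⊑ F₁ → x ⊑ F₂ →
                          apply (reflection h₁) x ≡ apply (reflection h₂) x
  reflection-consistent {x} {F₁} h₁ h₂ x⊑F₁ x⊑F₂ =
    coatoms-connected (suc (suc n)) {Q = Agree} (top-bound x) step
      (facet-coatom x⊑F₁ h₁) (facet-coatom x⊑F₂ h₂)
      -- The chosen reflection formally depends on the proof that `F₁` is a facet; rigidity compares
      -- the choices for two proofs.
      (λ h → reflections-agree (e⊑facet h) ⊑-refl ⊑-refl (reflection h₁) (reflection h) x⊑F₁) h₂
    where
    Agree : Face → Set
    Agree F = (h : Facet F) → apply (reflection h₁) x ≡ apply (reflection h) x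

    step : RidgeInvariant x Fmax Agree
    step x⊑R R⊑F₂ R⊑F₃ _ _ h₂ h₃ hmax agree hF₃ =
      let hF₂ = coatom-facet (trans hmax (cong suc (sym h₂)))
      in trans (agree hF₂) (reflections-agree
           (e⊑ridge hF₂ (e⊑facet hF₂) R⊑F₂ (ridge-height hF₂ h₂))
           R⊑F₂ R⊑F₃ (reflection hF₂) (reflection hF₃) x⊑R)

  -- Gluing the reflections to an automorphism.

  facet-above : ∀ {x} → x ≢ Fmax → ∃[ F ] (x ⊑ F × Facet F)
  facet-above x≢ = let (F , x⊑F , _ , h) = coatom-above (≤Fmax _ , x≢)
                   in F , x⊑F , coatom-facet h

  -- The decision is an explicit argument so that `glue-at-spec` can split on it. The facet chosen
  -- above `x` is immaterial by `reflection-consistent`.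
  glue-at : ∀ x → Dec (x ≡ Fmax) → Face
  glue-at _ (yes _) = Fmax
  glue-at x (no x≢) = apply (reflection (proj₂ (proj₂ (facet-above x≢)))) x

  glue : Face → Face
  glue x = glue-at x (x ≟ Fmax)

  glue-Fmax : glue Fmax ≡ Fmax
  glue-Fmax with Fmax ≟ Fmax
  ... | yes _ = refl
  ... | no ≢  = contradiction refl ≢

  facet-not-above-Fmax : ∀ {F} → Facet F → ¬ Fmax ⊑ F
  facet-not-above-Fmax hF Fmax⊑F = contradiction (height-mono-≤ Fmax⊑F)
    (<⇒≱ (≤-reflexive (trans (cong suc hF) (sym height-Fmax))))

  glue-at-spec : ∀ {x F} d (hF : Facet F) → x ⊑ F → glue-at x d ≡ apply (reflection hF) x
  glue-at-spec (yes refl) hF x⊑F = contradiction x⊑F (facet-not-above-Fmax hF)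
  glue-at-spec (no x≢)    hF x⊑F =
    let (_ , x⊑F' , hF') = facet-above x≢
    in reflection-consistent hF' hF x⊑F' x⊑F

  glue-spec : ∀ {x F} (hF : Facet F) → x ⊑ F → glue x ≡ apply (reflection hF) x
  glue-spec {x} = glue-at-spec (x ≟ Fmax)

  glue-mono : ∀ {x y} → x ⊑ y → glue x ⊑ glue y
  glue-mono {x} {y} x⊑y with y ≟ Fmax
  ... | yes refl = ≤Fmax _
  ... | no y≢    = let (_ , y⊑F , hF) = facet-above y≢
                   in subst (_⊑ apply (reflection hF) y)
                        (sym (glue-spec hF (⊑-trans x⊑y y⊑F)))
                        (mono (embedding (reflection hF)) x⊑y y⊑F)

  glue-involutive : ∀ x → glue (glue x) ≡ x
  glue-involutive x with x ≟ Fmax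
  ... | yes refl = glue-Fmax
  ... | no x≢    = let (_ , x⊑F , hF) = facet-above x≢
                       r              = reflection hF
                   in trans (glue-spec hF (apply-⊑ hF r x⊑F)) (reflection-involutive hF r x⊑F)

  glue-height : ∀ x → height (glue x) ≡ height x
  glue-height x with x ≟ Fmax
  ... | yes refl = refl
  ... | no x≢    = let (_ , x⊑F , hF) = facet-above x≢
                   in height-preserve (embedding (reflection hF)) x⊑F

  glue-above : ∀ {x} → e ⊑ x → glue x ≡ x
  glue-above {x} e⊑x with x ≟ Fmax
  ... | yes refl = refl
  ... | no x≢    = let (_ , x⊑F , hF) = facet-above x≢
                   in above (reflection hF) e⊑x x⊑F

  glue-v : glue v ≡ v'
  glue-v = trans (glue-spec F₀-height (⊑-trans v⊑e (e⊑facet F₀-height)))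
                 (vertex (reflection F₀-height))

  glue-automorphism : Automorphism
  glue-automorphism = record
    { to      = glue
    ; from    = glue
    ; to-from = glue-involutive
    ; from-to = glue-involutive
    ; to-mono = glue-mono
    ; to-refl = λ le → subst₂ _⊑_ (glue-involutive _) (glue-involutive _) (glue-mono le)
    ; to-rank = λ x → trans (rank≡ (glue-height x)) (sym (rank-height x))
    }

  Φ₀' : Flag
  Φ₀' = swap-vertex Φ₀ refl

  adjacent : Adjacent Φ₀ Φ₀'
  adjacent = suc zero , v≢v' , λ
    { zero _ → refl ; (suc zero) ≢1 → contradiction refl ≢1 ; (suc (suc i)) _ → refl }

  same-orbit : SameOrbit Φ₀ Φ₀'
  same-orbit = glue-automorphism , λ
    { zero          → trans (height-0 (trans (glue-height _) (height-face Φ₀ zero)))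
                            (sym (height-0 (height-face Φ₀ zero)))
    ; (suc zero)    → glue-v
    ; (suc (suc i)) → glue-above (face-chain Φ₀ (s≤s (s≤s z≤n)))
    }

-- Decidability under double negation, and the conclusion.

¬¬-∀Fin : ∀ {m} {A : Fin m → Set} → (∀ i → ¬ ¬ A i) → ¬ ¬ (∀ i → A i)
¬¬-∀Fin {zero}  ¬¬a k = k λ ()
-- The goal is a contradiction, so the finitely many values can be extracted one at a time and
-- handed to `k` together.
¬¬-∀Fin {suc m} ¬¬a k = ¬¬a zero λ a₀ → ¬¬-∀Fin (¬¬a ∘ suc) λ as →
  k λ { zero → a₀ ; (suc i) → as i }

-- The order of a finite polytope is decidable only up to double negation.
¬¬-enumeration : ∀ {N} (P : Polytope N) → IsFinite P → ¬ ¬ Enumeration P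
¬¬-enumeration P (m , bij) k =
  ¬¬-∀Fin (λ i → ¬¬-∀Fin (λ j → ¬¬-excluded-middle {A = decode i ⊑ decode j})) λ dec → k record
    { _≟_            = via-injection (↔⇒↣ bij) Fin._≟_
    ; _⊑?_           = λ x y → subst₂ (λ a b → Dec (a ⊑ b)) (decode-encode x) (decode-encode y)
                                 (dec (encode x) (encode y))
    ; faces          = map decode (allFin m)
    ; faces-complete = λ x → subst (_∈ map decode (allFin m)) (decode-encode x)
                               (∈-map⁺ decode (∈-allFin (encode x)))
    }
  where
  open Polytope P renaming (_≤_ to _⊑_)
  open Inverse bij using () renaming (to to encode; from to decode; strictlyInverseʳ to decode-encode)

theorem3p2 : (n : ℕ) → 3 ≤ n → (K : Polytope n) → IsRegular K → IsFlat K (+ 1) (+ n - + 1) →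
    (P : Polytope (suc n)) → ¬ (IsFinite P × IsChiral P × HasFacets P K)
theorem3p2 n 3≤n K K-regular K-flat P (finite , ((Φ₀ , _) , adjacent-apart) , facets) =
  -- The theorem is a negation, so an enumeration known only under double negation may be used.
  ¬¬-enumeration P finite λ enum →
    let open Gluing 3≤n K K-regular K-flat P enum facets Φ₀
    in adjacent-apart Φ₀ Φ₀' adjacent same-orbit
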